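{- The number of order types of $3\times3$ semimagic squares, i.e. the number of linear orderings of the nine cells that are induced by $3\times 3$ semimagic squares (with arbitrarily large entries), is $1296$. Up to the $72$ symmetries of a semimagic square there are exactly $18$ symmetry classes of order types.
   Context: A $3\times3$ semimagic square (in the strong sense) is a $3\times 3$ matrix of pairwise distinct positive integers in which all three row sums and all three column sums are equal. Its order type is the linear ordering of the nine cells in order of increasing value of their entries. The symmetries form the group of order $72=2(3!)^2$ generated by row permutations, column permutations and reflection in the main diagonal (transposition). -}

module Defs where

open import Level using (0ℓ) renaming (suc to lsuc)
open import Algebra.Definitions.RawMonoid using (sum)
open import Data.Fin.Base using (Fin)
open import Data.Fin.Permutation using (Permutation′)
open import Data.Nat.Base using (ℕ; _<_; +-0-rawMonoid)
open import Data.Nat.Properties using (<-trans; <-irrefl; <-cmp)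
open import Data.Product.Algebra using (×-comm)
open import Data.Product.Base using (Σ; ∃; _×_; _,_; proj₁; uncurry)
open import Data.Product.Function.NonDependent.Propositional using (_×-↔_)
open import Data.Vec.Functional using (Vector; transpose)
open import Function.Base using (_∘_)
open import Function.Bundles using (Bijection; Inverse; _↔_; _⇔_; mk⇔)
open import Function.Construct.Composition using (_↔-∘_; _⇔-∘_)
open import Function.Construct.Identity using (↔-id; ⇔-id)
open import Function.Construct.Symmetry using (↔-sym; ⇔-sym)
open import Function.Definitions using (Injective)
open import Relation.Binary.Bundles using (Setoid)
open import Relation.Binary.Core using (Rel)
open import Relation.Binary.Definitions using (Trichotomous; tri<; tri≈; tri>)
open import Relation.Binary.PropositionalEquality
  using (_≡_; sym; cong; subst₂; resp₂; isEquivalence; setoid)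
open import Relation.Binary.Structures using (IsStrictTotalOrder)

Cell : Set
Cell = Fin 3 × Fin 3

Matrix : Set
Matrix = Vector (Vector ℕ 3) 3

rowSum colSum : Matrix → Fin 3 → ℕ
rowSum m i = sum +-0-rawMonoid (m i)
colSum m j = sum +-0-rawMonoid (transpose m j)

record SemimagicSquare : Set where
  field
    matrix   : Matrix

  entry : Cell → ℕ
  entry = uncurry matrix

  field
    positive : ∀ c → 0 < entry c
    distinct : Injective _≡_ _≡_ entry
    lineSum  : ℕ
    rows     : ∀ i → rowSum matrix i ≡ lineSum
    columns  : ∀ j → colSum matrix j ≡ lineSum

record LinearOrdering : Set₁ where
  infix 4 _≺_
  field
    _≺_                : Rel Cell 0ℓ
    isStrictTotalOrder : IsStrictTotalOrder _≡_ _≺_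

-- Orderings are relations, so they are compared extensionally.
infix 4 _≋_
_≋_ : Rel LinearOrdering 0ℓ
O ≋ P = ∀ c d → (c O.≺ d) ⇔ (c P.≺ d)
  where
  module O = LinearOrdering O
  module P = LinearOrdering P

orderType : SemimagicSquare → LinearOrdering
orderType S = record
  { _≺_                = λ c d → entry c < entry d
  ; isStrictTotalOrder = record
    { isStrictPartialOrder = record
      { isEquivalence = isEquivalence
      ; irrefl        = λ eq → <-irrefl (cong entry eq)
      ; trans         = <-trans
      ; <-resp-≈      = resp₂ _
      }
    ; compare = compare
    }
  }
  where
  open SemimagicSquare S

  compare : Trichotomous _≡_ (λ c d → entry c < entry d)
  compare c d with <-cmp (entry c) (entry d)
  ... | tri< lt ne gt = tri< lt (ne ∘ cong entry) gt
  ... | tri≈ lt eq gt = tri≈ lt (distinct eq) gt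
  ... | tri> lt ne gt = tri> lt (ne ∘ cong entry) gt

IsOrderType : LinearOrdering → Set
IsOrderType O = ∃ λ S → O ≋ orderType S

-- The square inducing an ordering is irrelevant to equality of order types.
OrderTypes : Setoid (lsuc 0ℓ) 0ℓ
OrderTypes = record
  { Carrier       = Σ LinearOrdering IsOrderType
  ; _≈_           = λ O P → proj₁ O ≋ proj₁ P
  ; isEquivalence = record
    { refl  = λ c d → ⇔-id _
    ; sym   = λ e c d → ⇔-sym (e c d)
    ; trans = λ e f c d → f c d ⇔-∘ e c d
    }
  }

-- The subgroup of permutations of the cells generated by the row permutations,
-- the column permutations and transposition.
data IsSymmetry : Cell ↔ Cell → Set where
  rowPerm    : (π : Permutation′ 3) → IsSymmetry (π ×-↔ ↔-id (Fin 3))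
  columnPerm : (π : Permutation′ 3) → IsSymmetry (↔-id (Fin 3) ×-↔ π)
  transposed : IsSymmetry (×-comm (Fin 3) (Fin 3))
  identity   : IsSymmetry (↔-id Cell)
  inverse    : ∀ {g} → IsSymmetry g → IsSymmetry (↔-sym g)
  compose    : ∀ {g h} → IsSymmetry g → IsSymmetry h → IsSymmetry (g ↔-∘ h)

Carries : Cell ↔ Cell → Rel LinearOrdering 0ℓ
Carries g O P = ∀ c d → (c O.≺ d) ⇔ (Inverse.to g c P.≺ Inverse.to g d)
  where
  module O = LinearOrdering O
  module P = LinearOrdering P

infix 4 _∼_
_∼_ : Rel LinearOrdering 0ℓ
O ∼ P = ∃ λ g → IsSymmetry g × Carries g O P

∼-sym : ∀ {O P} → O ∼ P → P ∼ O
∼-sym {O} {P} (g , s , e) = ↔-sym g , inverse s , λ c d →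
  ⇔-sym (e (from c) (from d)) ⇔-∘
  mk⇔ (subst₂ P._≺_ (sym (strictlyInverseˡ c)) (sym (strictlyInverseˡ d)))
      (subst₂ P._≺_ (strictlyInverseˡ c) (strictlyInverseˡ d))
  where
  open Inverse g using (from; strictlyInverseˡ)
  module P = LinearOrdering P

SymmetryClasses : Setoid (lsuc 0ℓ) 0ℓ
SymmetryClasses = record
  { Carrier       = Σ LinearOrdering IsOrderType
  ; _≈_           = λ O P → proj₁ O ∼ proj₁ P
  ; isEquivalence = record
    { refl  = ↔-id _ , identity , λ c d → ⇔-id _
    ; sym   = λ {O} {P} → ∼-sym {proj₁ O} {proj₁ P}
    ; trans = λ (g , s , e) (h , t , f) →
        h ↔-∘ g , compose t s ,
        λ c d → f (Inverse.to g c) (Inverse.to g d) ⇔-∘ e c d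
    }
  }

HasCardinality : ∀ {a ℓ} → Setoid a ℓ → ℕ → Set _
HasCardinality S n = Bijection (setoid (Fin n)) S

{-# OPTIONS --safe #-}

-- Up to a symmetry, the smallest entry m of a semimagic square lies in the
-- corner, and the entries x₀₁ < x₀₂, x₁₀ < x₂₀, x₀₁ < x₁₀ are in order. The
-- symmetry achieving this is unique, so it acts freely on the order types and
-- the first count is 72 times the second. In such a normal square write
-- x₁₁ = m + p, x₁₂ = m + q, x₂₁ = m + r, x₂₂ = m + t. The line sums force the
-- other entries, and normality becomes q < r and r + t < p + q. Under these
-- constraints the order type is decided by the comparisons of r with p, q with
-- p, q with t, r with t, r with q + t, p with q + t and p with r + t, of whose
-- outcomes exactly 18 are consistent.

module Submission where

open import Defs
open import Algebra.Properties.CommutativeMonoid.Sum using (sum-permute)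
open import Data.Bool.Base using (Bool; true; false; not)
open import Data.Fin using (Fin; zero; suc; punchIn; #_)
open import Data.Fin.Patterns
open import Data.Fin.Permutation as Perm using (Permutation′; _⟨$⟩ʳ_; _∘ₚ_)
import Data.Fin.Properties as Fin
open import Data.List.Base using (List; []; _∷_; allFin; cartesianProduct)
open import Data.List.Extrema.Nat using (argmin; f[argmin]≤f[xs])
open import Data.List.Membership.Propositional using (_∈_)
open import Data.List.Membership.Propositional.Properties
  using (∈-allFin; ∈-cartesianProduct⁺)
import Data.List.Relation.Unary.All as All
open import Data.List.Relation.Unary.AllPairs using (AllPairs; _∷_)
open import Data.List.Relation.Unary.Any using (here; there; any?)
open import Data.List.Relation.Unary.Linked as Linked using (Linked; [-]; _∷_; linked?)
open import Data.List.Relation.Unary.Linked.Properties using (Linked⇒AllPairs)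
open import Data.Nat.Base using (ℕ; zero; suc; _+_; _*_; _≤_; _<_; z≤n; s≤s; _!)
open import Data.Nat.Properties renaming (_≟_ to _≟ⁿ_)
open import Data.Nat.Tactic.RingSolver using (solve-∀)
open import Data.Product.Algebra using (×-comm)
open import Data.Product.Base using (∃; _×_; _,_; proj₁; proj₂; uncurry; curry; map₂)
open import Data.Product.Function.NonDependent.Propositional using (_×-↔_)
open import Data.Product.Function.NonDependent.Setoid using (_×-bijection_)
open import Data.Product.Properties using (≡-dec)
open import Data.Product.Relation.Binary.Pointwise.NonDependent using (_×ₛ_; Pointwise-≡↔≡)
open import Data.Sum.Base using (_⊎_; inj₁; inj₂)
open import Data.Vec.Base as Vec using (Vec)
import Data.Vec.Functional as Vector
open import Function.Base using (_∘_; _on_)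
open import Function.Bundles using (Bijection; Equivalence; Injection; Inverse; _↔_; _⇔_; mk⇔)
open import Function.Construct.Composition using (bijection; _↔-∘_; _⇔-∘_)
open import Function.Construct.Identity as Identity using (↔-id; ⇔-id)
import Function.Construct.Symmetry as Symmetry
open import Function.Definitions using (Injective; Surjective)
open import Function.Properties.Inverse using (Inverse⇒Bijection; ↔⇒⤖; ↔⇒↣)
open import Level using (Level; 0ℓ)
open import Relation.Binary.Bundles using (Setoid)
open import Relation.Binary.Core using (Rel)
open import Relation.Binary.Definitions using (DecidableEquality; Tri; tri<; tri≈; tri>)
open import Relation.Binary.PropositionalEquality
open import Relation.Binary.Structures using (IsStrictTotalOrder)
open import Relation.Nullary.Decidable using (Dec; from-yes; _→-dec_; False; toWitnessFalse)
open import Relation.Nullary.Negation using (¬_; contradiction)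

private
  variable
    a ℓ : Level
    A : Set a

open SemimagicSquare using (entry)
open Inverse using (to; from)

_≟_ : DecidableEquality Cell
_≟_ = ≡-dec Fin._≟_ Fin._≟_

-- Counting permutations

infixr 2 _×-cardinality_
_×-cardinality_ : ∀ {a b ℓ₁ ℓ₂ m n} {S : Setoid a ℓ₁} {T : Setoid b ℓ₂} →
                  HasCardinality S m → HasCardinality T n →
                  HasCardinality (S ×ₛ T) (m * n)
f ×-cardinality g =
  bijection (bijection (↔⇒⤖ Fin.*↔×)
                       (Inverse⇒Bijection (Symmetry.inverse Pointwise-≡↔≡)))
            (f ×-bijection g)

Permutations : ℕ → Setoid 0ℓ 0ℓ
Permutations n = record
  { Carrier       = Permutation′ n
  ; _≈_           = Perm._≈_
  ; isEquivalence = record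
    { refl  = λ _ → refl
    ; sym   = λ e i → sym (e i)
    ; trans = λ e f i → trans (e i) (f i)
    }
  }

-- A permutation of `suc n` points amounts to the image of `0F` together with a permutation of what
-- remains, which is the recursion of the factorial.
insertion : ∀ n → Bijection (setoid (Fin (suc n)) ×ₛ Permutations n) (Permutations (suc n))
insertion n = record
  { to        = ins
  ; cong      = ins-cong
  ; bijective = injective , surjective
  }
  where
  module S = Setoid (setoid (Fin (suc n)) ×ₛ Permutations n)
  module T = Setoid (Permutations (suc n))

  ins : S.Carrier → T.Carrier
  ins (i , π) = Perm.insert 0F i π

  ins-cong : ∀ {x y} → x S.≈ y → ins x T.≈ ins y
  ins-cong (refl , e) zero    = refl
  ins-cong {i , _} (refl , e) (suc k) = cong (punchIn i) (e k)

  injective : Injective S._≈_ T._≈_ ins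
  injective {i , π} {j , ρ} e with e 0F
  ... | refl = refl , λ k → Fin.punchIn-injective i _ _ (e (suc k))

  surjective : Surjective S._≈_ T._≈_ ins
  surjective π = (π ⟨$⟩ʳ 0F , Perm.remove 0F π) , λ {x} e k →
    trans (ins-cong {x} e k) (Perm.insert-remove 0F π k)

permutations : ∀ n → HasCardinality (Permutations n) (n !)
permutations 0 = record
  { to        = λ _ → Perm.id
  ; cong      = λ _ ()
  ; bijective = (λ { {0F} {0F} _ → refl }) , λ π → 0F , λ _ ()
  }
permutations (suc n) =
  bijection (Identity.bijection _ ×-cardinality permutations n) (insertion n)

-- Symmetries

-- A row permutation and a column permutation, followed by transposition if the
-- flag is set.
Symmetries : Setoid 0ℓ 0ℓ
Symmetries = setoid Bool ×ₛ (Permutations 3 ×ₛ Permutations 3)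

open Setoid Symmetries using () renaming (Carrier to Sym; _≈_ to _≈ˢ_)

symmetries : HasCardinality Symmetries 72
symmetries = ↔⇒⤖ Fin.2↔Bool ×-cardinality permutations 3 ×-cardinality permutations 3

act : Sym → Cell ↔ Cell
act (false , σ , τ) = (σ ×-↔ ↔-id _) ↔-∘ (↔-id _ ×-↔ τ)
act (true  , σ , τ) = ×-comm _ _ ↔-∘ act (false , σ , τ)

act-injective : ∀ s t → (∀ c → to (act s) c ≡ to (act t) c) → s ≈ˢ t
act-injective (false , σ , τ) (false , σ′ , τ′) e =
  refl , (λ i → cong proj₁ (e (i , 0F))) , λ j → cong proj₂ (e (0F , j))
act-injective (true  , σ , τ) (true  , σ′ , τ′) e =
  refl , (λ i → cong proj₂ (e (i , 0F))) , λ j → cong proj₁ (e (0F , j))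
-- If the flags differ, one map keeps the first two cells of row `0F` in a common row while the
-- other puts them into different rows.
act-injective (false , σ , τ) (true  , σ′ , τ′) e =
  contradiction (Injection.injective (↔⇒↣ τ′)
    (trans (sym (cong proj₁ (e (0F , 0F)))) (cong proj₁ (e (0F , 1F))))) λ ()
act-injective (true  , σ , τ) (false , σ′ , τ′) e =
  contradiction (Injection.injective (↔⇒↣ τ)
    (trans (cong proj₁ (e (0F , 0F))) (sym (cong proj₁ (e (0F , 1F)))))) λ ()

infixl 7 _∙_
-- The wreath product law: `act s` after `act t`, where moving a transposition past a row and a
-- column permutation interchanges the two. The factors appear reversed because `_∘ₚ_` applies its
-- left argument first.
_∙_ : Sym → Sym → Sym
(b , σ , τ) ∙ (false , σ′ , τ′) = b     , σ′ ∘ₚ σ , τ′ ∘ₚ τ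
(b , σ , τ) ∙ (true  , σ′ , τ′) = not b , σ′ ∘ₚ τ , τ′ ∘ₚ σ

act-∙ : ∀ s t c → to (act s) (to (act t) c) ≡ to (act (s ∙ t)) c
act-∙ (false , _) (false , _) c = refl
act-∙ (false , _) (true  , _) c = refl
act-∙ (true  , _) (false , _) c = refl
act-∙ (true  , _) (true  , _) c = refl

infix 8 _⁻¹
_⁻¹ : Sym → Sym
(false , σ , τ) ⁻¹ = false , Perm.flip σ , Perm.flip τ
(true  , σ , τ) ⁻¹ = true  , Perm.flip τ , Perm.flip σ

act-⁻¹ : ∀ s c → from (act s) c ≡ to (act (s ⁻¹)) c
act-⁻¹ (false , _) c = refl
act-⁻¹ (true  , _) c = refl

act-isSymmetry : ∀ s → IsSymmetry (act s)
act-isSymmetry (false , σ , τ) = compose (rowPerm σ) (columnPerm τ)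
act-isSymmetry (true  , σ , τ) = compose transposed (act-isSymmetry (false , σ , τ))

-- The maps `act s` include the generators and are closed under inverse and composition, so the
-- generated group has no elements beyond these 72.
isSymmetry⇒act : ∀ {g} → IsSymmetry g → ∃ λ s → ∀ c → to g c ≡ to (act s) c
isSymmetry⇒act (rowPerm π)    = (false , π , Perm.id) , λ _ → refl
isSymmetry⇒act (columnPerm π) = (false , Perm.id , π) , λ _ → refl
isSymmetry⇒act transposed     = (true , Perm.id , Perm.id) , λ _ → refl
isSymmetry⇒act identity       = (false , Perm.id , Perm.id) , λ _ → refl
isSymmetry⇒act (inverse {g} x) with isSymmetry⇒act x
... | s , e = s ⁻¹ , λ c → trans
  (Inverse.inverseʳ g (sym (trans (e _) (Inverse.inverseˡ (act s) refl))))
  (act-⁻¹ s c)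
isSymmetry⇒act (compose {g} {h} x y) with isSymmetry⇒act x | isSymmetry⇒act y
... | s , e | t , f = s ∙ t , λ c →
  trans (e (to h c)) (trans (cong (to (act s)) (f c)) (act-∙ s t c))

-- Entries are pulled back along `act s`, so that `act s` carries the order type of the new square
-- to that of `S` by definition.
relabel : Sym → SemimagicSquare → SemimagicSquare
relabel s S = record
  { matrix   = curry (entry S ∘ to (act s))
  ; positive = positive ∘ to (act s)
  ; distinct = Injection.injective (↔⇒↣ (act s)) ∘ distinct
  ; lineSum  = lineSum
  ; rows     = rows′ s
  ; columns  = columns′ s
  }
  where
  open SemimagicSquare S hiding (entry)

  permuted : ∀ (f : Fin 3 → ℕ) π {n} →
             Vector.foldr _+_ 0 f ≡ n → Vector.foldr _+_ 0 (f ∘ (π ⟨$⟩ʳ_)) ≡ n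
  permuted f π = trans (sym (sum-permute +-0-commutativeMonoid f π))

  rows′ : ∀ s i → rowSum (curry (entry S ∘ to (act s))) i ≡ lineSum
  rows′ (false , σ , τ) i = permuted (matrix (σ ⟨$⟩ʳ i)) τ (rows _)
  rows′ (true  , σ , τ) i = permuted (λ k → matrix k (σ ⟨$⟩ʳ i)) τ (columns _)

  columns′ : ∀ s j → colSum (curry (entry S ∘ to (act s))) j ≡ lineSum
  columns′ (false , σ , τ) j = permuted (λ k → matrix k (τ ⟨$⟩ʳ j)) σ (columns _)
  columns′ (true  , σ , τ) j = permuted (matrix (τ ⟨$⟩ʳ j)) σ (rows _)

-- Normal orderings

record Normal (O : LinearOrdering) : Set where
  open LinearOrdering O
  field
    corner   : ∀ c → ¬ c ≺ (0F , 0F)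
    row      : (0F , 1F) ≺ (0F , 2F)
    column   : (1F , 0F) ≺ (2F , 0F)
    diagonal : (0F , 1F) ≺ (1F , 0F)

-- With `0F` fixed, the other two indices are either fixed or swapped, and a swap would give
-- `2F ⊏ 1F`.
fixes-ordered-pair : ∀ (σ : Permutation′ 3) (_⊏_ : Rel (Fin 3) 0ℓ) → ¬ (2F ⊏ 1F) →
                     σ ⟨$⟩ʳ 0F ≡ 0F → (σ ⟨$⟩ʳ 1F) ⊏ (σ ⟨$⟩ʳ 2F) →
                     ∀ i → σ ⟨$⟩ʳ i ≡ i
fixes-ordered-pair σ _⊏_ 2⋢1 e₀ lt
  with injective ← Injection.injective (↔⇒↣ σ)
  with σ ⟨$⟩ʳ 1F in e₁ | σ ⟨$⟩ʳ 2F in e₂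
... | 0F | _  = contradiction (injective (trans e₀ (sym e₁))) λ ()
... | _  | 0F = contradiction (injective (trans e₀ (sym e₂))) λ ()
... | 1F | 1F = contradiction (injective (trans e₁ (sym e₂))) λ ()
... | 2F | 2F = contradiction (injective (trans e₁ (sym e₂))) λ ()
... | 2F | 1F = contradiction lt 2⋢1
... | 1F | 2F = λ { 0F → e₀ ; 1F → e₁ ; 2F → e₂ }

module _ {O P : LinearOrdering} (N : Normal O) (M : Normal P) where
  private
    module N = Normal N
    module M = Normal M
    open LinearOrdering P using (_≺_)
    open IsStrictTotalOrder (LinearOrdering.isStrictTotalOrder P) using (compare; asym)

  -- Minima go to minima: the image of the corner cannot precede the corner of `P`, and if it came
  -- later, the cell sent to the corner would precede the corner of `O`.
  carries⇒fixes-corner : ∀ g → Carries g O P → to g (0F , 0F) ≡ (0F , 0F)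
  carries⇒fixes-corner g e with compare (to g (0F , 0F)) (0F , 0F)
  ... | tri< lt _ _ = contradiction lt (M.corner _)
  ... | tri≈ _ eq _ = eq
  ... | tri> _ _ gt = contradiction
    (Equivalence.from (e _ _)
      (subst (_≺ to g (0F , 0F)) (sym (Inverse.strictlyInverseˡ g (0F , 0F))) gt))
    (N.corner _)

  -- This is the freeness of the action. Once the corner is fixed, the row and column conditions
  -- leave no choice for `σ` and `τ`, and the diagonal condition excludes transposition.
  act-rigid : ∀ s → Carries (act s) O P → ∀ c → to (act s) c ≡ c
  act-rigid s e with carries⇒fixes-corner (act s) e
  act-rigid (false , σ , τ) e | e₀ = λ (i , j) → cong₂ _,_ (fix-σ i) (fix-τ j)
    where
    fix-σ : ∀ i → σ ⟨$⟩ʳ i ≡ i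
    fix-σ = fixes-ordered-pair σ (λ i j → (i , 0F) ≺ (j , 0F)) (asym M.column) (cong proj₁ e₀)
      (subst (λ k → (σ ⟨$⟩ʳ 1F , k) ≺ (σ ⟨$⟩ʳ 2F , k)) (cong proj₂ e₀)
        (Equivalence.to (e _ _) N.column))

    fix-τ : ∀ j → τ ⟨$⟩ʳ j ≡ j
    fix-τ = fixes-ordered-pair τ (λ i j → (0F , i) ≺ (0F , j)) (asym M.row) (cong proj₂ e₀)
      (subst (λ k → (k , τ ⟨$⟩ʳ 1F) ≺ (k , τ ⟨$⟩ʳ 2F)) (cong proj₁ e₀)
        (Equivalence.to (e _ _) N.row))
  -- Transposition turns the column of `O` into the row of `P` and conversely, so here `σ` is tested
  -- against `M.row` and `τ` against `M.column`.
  act-rigid (true , σ , τ) e | e₀ = contradiction M.diagonal (asym transposed-diagonal)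
    where
    fix-σ : ∀ i → σ ⟨$⟩ʳ i ≡ i
    fix-σ = fixes-ordered-pair σ (λ i j → (0F , i) ≺ (0F , j)) (asym M.row) (cong proj₂ e₀)
      (subst (λ k → (k , σ ⟨$⟩ʳ 1F) ≺ (k , σ ⟨$⟩ʳ 2F)) (cong proj₁ e₀)
        (Equivalence.to (e _ _) N.column))

    fix-τ : ∀ j → τ ⟨$⟩ʳ j ≡ j
    fix-τ = fixes-ordered-pair τ (λ i j → (i , 0F) ≺ (j , 0F)) (asym M.column) (cong proj₁ e₀)
      (subst (λ k → (τ ⟨$⟩ʳ 1F , k) ≺ (τ ⟨$⟩ʳ 2F , k)) (cong proj₂ e₀)
        (Equivalence.to (e _ _) N.row))

    transposed-diagonal : (1F , 0F) ≺ (0F , 1F)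
    transposed-diagonal = subst₂ _≺_
      (cong₂ _,_ (fix-τ 1F) (fix-σ 0F)) (cong₂ _,_ (fix-τ 0F) (fix-σ 1F))
      (Equivalence.to (e _ _) N.diagonal)

  rigid : ∀ {g} → IsSymmetry g → Carries g O P → ∀ c → to g c ≡ c
  rigid x e c with isSymmetry⇒act x
  ... | s , h = trans (h c) (act-rigid s
    (λ c d → subst₂ (λ c′ d′ → _ ⇔ (c′ ≺ d′)) (h c) (h d) (e c d)) c)

SortedFrom : (Fin 3 → ℕ) → Fin 3 → Permutation′ 3 → Set
SortedFrom f i σ = σ ⟨$⟩ʳ 0F ≡ i × f (σ ⟨$⟩ʳ 1F) < f (σ ⟨$⟩ʳ 2F)

-- Exchanging `0F` and `i` brings `i` to the front. If the other two values are then out of order, a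
-- swap of `1F` and `2F` is applied first.
sort-others : ∀ {f : Fin 3 → ℕ} → Injective _≡_ _≡_ f → ∀ i → ∃ (SortedFrom f i)
sort-others {f} f-injective i = either (<-cmp (f (σ ⟨$⟩ʳ 1F)) (f (σ ⟨$⟩ʳ 2F)))
  where
  σ : Permutation′ 3
  σ = Perm.transpose 0F i

  either : Tri (f (σ ⟨$⟩ʳ 1F) < f (σ ⟨$⟩ʳ 2F))
               (f (σ ⟨$⟩ʳ 1F) ≡ f (σ ⟨$⟩ʳ 2F))
               (f (σ ⟨$⟩ʳ 2F) < f (σ ⟨$⟩ʳ 1F)) →
           ∃ (SortedFrom f i)
  either (tri< lt _ _) = σ , refl , lt
  either (tri≈ _ eq _) =
    contradiction (Injection.injective (↔⇒↣ σ) {1F} {2F} (f-injective eq)) λ ()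
  either (tri> _ _ gt) = Perm.transpose 1F 2F ∘ₚ σ , refl , gt

complete⇒minimum : ∀ (f : A → ℕ) x xs → (∀ y → y ∈ xs) → ∃ λ z → ∀ y → f z ≤ f y
complete⇒minimum f x xs complete =
  argmin f x xs , λ y → All.lookup (f[argmin]≤f[xs] x xs) (complete y)

smallest : ∀ (f : Cell → ℕ) → ∃ λ c → ∀ d → f c ≤ f d
smallest f = complete⇒minimum f (0F , 0F) (cartesianProduct (allFin 3) (allFin 3))
  λ (i , j) → ∈-cartesianProduct⁺ (∈-allFin i) (∈-allFin j)

-- The row and column of the smallest entry are moved to the front and the rest of that column and
-- row is sorted; the diagonal condition then decides whether to transpose.
normalise : ∀ S → ∃ λ s → Normal (orderType (relabel s S))
normalise S = orient (smallest (entry S))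
  where
  orient : (∃ λ c → ∀ d → entry S c ≤ entry S d) → ∃ λ s → Normal (orderType (relabel s S))
  orient ((i , j) , least)
    with sort-others (cong proj₁ ∘ SemimagicSquare.distinct S {_ , j} {_ , j}) i
       | sort-others (cong proj₂ ∘ SemimagicSquare.distinct S {i , _} {i , _}) j
  ... | σ , refl , column | τ , refl , row
    with <-cmp (entry S (σ ⟨$⟩ʳ 0F , τ ⟨$⟩ʳ 1F)) (entry S (σ ⟨$⟩ʳ 1F , τ ⟨$⟩ʳ 0F))
  ... | tri< lt _ _ = (false , σ , τ) , record
    { corner = λ _ → ≤⇒≯ (least _) ; row = row ; column = column ; diagonal = lt }
  ... | tri≈ _ eq _ = contradiction
    (Injection.injective (↔⇒↣ σ) {0F} {1F} (cong proj₁ (SemimagicSquare.distinct S eq))) λ ()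
  -- Interchanging `σ` and `τ` along with transposing makes the sorted row the new column and
  -- conversely, and reverses the diagonal comparison.
  ... | tri> _ _ gt = (true , τ , σ) , record
    { corner = λ _ → ≤⇒≯ (least _) ; row = column ; column = row ; diagonal = gt }

-- Orderings along a chain

Increasing : (A → ℕ) → List A → Set _
Increasing f = Linked (_<_ on f)

increasing? : ∀ (f : A → ℕ) xs → Dec (Increasing f xs)
increasing? f = linked? (λ x y → f x <? f y)

allPairs-compare : ∀ {R : Rel A ℓ} {xs x y} → AllPairs R xs → x ∈ xs → y ∈ xs →
                   x ≡ y ⊎ R x y ⊎ R y x
allPairs-compare (_ ∷ _)  (here refl) (here refl) = inj₁ refl
allPairs-compare (r ∷ _)  (here refl) (there y∈)  = inj₂ (inj₁ (All.lookup r y∈))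
allPairs-compare (r ∷ _)  (there x∈)  (here refl) = inj₂ (inj₂ (All.lookup r x∈))
allPairs-compare (_ ∷ rs) (there x∈)  (there y∈)  = allPairs-compare rs x∈ y∈

module _ {f : A → ℕ} {xs} (f↗ : Increasing f xs) (complete : ∀ x → x ∈ xs) where

  increasing⇒injective : Injective _≡_ _≡_ f
  increasing⇒injective {x} {y} eq
    with allPairs-compare (Linked⇒AllPairs <-trans f↗) (complete x) (complete y)
  ... | inj₁ x≡y       = x≡y
  ... | inj₂ (inj₁ lt) = contradiction lt (<-irrefl eq)
  ... | inj₂ (inj₂ gt) = contradiction gt (<-irrefl (sym eq))

  -- A chain through all elements determines the ordering. Zipping the two chains compares `x` and
  -- `y` under `f` and `g` at once, so the comparisons cannot disagree.
  increasing⇒monotone : ∀ {g} → Increasing g xs → ∀ {x y} → f x < f y → g x < g y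
  increasing⇒monotone g↗ {x} {y} lt
    with allPairs-compare
           (Linked⇒AllPairs (λ (p , q) (p′ , q′) → <-trans p p′ , <-trans q q′)
                            (Linked.zip (f↗ , g↗)))
           (complete x) (complete y)
  ... | inj₁ refl             = contradiction lt (<-irrefl refl)
  ... | inj₂ (inj₁ (_ , lt′)) = lt′
  ... | inj₂ (inj₂ (gt , _))  = contradiction lt (<-asym gt)

increasing⇒≋ : ∀ S T {xs} → Increasing (entry S) xs → Increasing (entry T) xs →
               (∀ c → c ∈ xs) → orderType S ≋ orderType T
increasing⇒≋ S T S↗ T↗ complete c d = mk⇔
  (increasing⇒monotone {f = entry S} S↗ complete {g = entry T} T↗)
  (increasing⇒monotone {f = entry T} T↗ complete {g = entry S} S↗)

-- The normal order types

-- A normal square less its smallest entry, as determined by the lower right block.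
block : (p q r t : ℕ) → Cell → ℕ
block p q r t = uncurry (row₀ Vector.∷ row₁ Vector.∷ row₂ Vector.∷ Vector.[])
  where
  row₀ row₁ row₂ : Vector.Vector ℕ 3
  row₀ = 0     Vector.∷ q + t Vector.∷ p + r Vector.∷ Vector.[]
  row₁ = r + t Vector.∷ p     Vector.∷ q     Vector.∷ Vector.[]
  row₂ = p + q Vector.∷ r     Vector.∷ t     Vector.∷ Vector.[]

-- Cells are named after their entries in `block p q r t`.
pattern O  = 0F , 0F
pattern QT = 0F , 1F
pattern PR = 0F , 2F
pattern RT = 1F , 0F
pattern P  = 1F , 1F
pattern Q  = 1F , 2F
pattern PQ = 2F , 0F
pattern R  = 2F , 1F
pattern T  = 2F , 2F

pattern chain a b c d e f g h i =
  a List.∷ b List.∷ c List.∷ d List.∷ e List.∷ f List.∷ g List.∷ h List.∷ i List.∷ List.[]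

-- The comparisons of entries are linear in `p`, `q`, `r`, `t`, so their hyperplanes cut the cone of
-- normal squares into chambers. A chamber is recorded by an integral sample point and the chain of
-- cells from smallest to largest.
record Chamber : Set where
  constructor chamber
  field
    p q r t : ℕ
    order   : List Cell

  offset : Cell → ℕ
  offset = block p q r t

-- One sample point for each consistent outcome of the comparisons, in the order of the branches of
-- `block-increasing`.
chambers : Vec Chamber 18
chambers =
  chamber 7 3 4 5 (chain O Q R T P QT RT PQ PR) Vec.∷
  chamber 8 2 4 5 (chain O Q R T QT P RT PQ PR) Vec.∷
  chamber 6 1 2 3 (chain O Q R T QT RT P PQ PR) Vec.∷
  chamber 8 4 6 5 (chain O Q T R P QT RT PQ PR) Vec.∷
  chamber 6 2 4 3 (chain O Q T R QT P RT PQ PR) Vec.∷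
  chamber 8 2 4 3 (chain O Q T R QT RT P PQ PR) Vec.∷
  chamber 8 2 6 3 (chain O Q T QT R P RT PQ PR) Vec.∷
  chamber 7 1 4 2 (chain O Q T QT R RT P PQ PR) Vec.∷
  chamber 6 4 5 3 (chain O T Q R P QT RT PQ PR) Vec.∷
  chamber 8 4 6 3 (chain O T Q R QT P RT PQ PR) Vec.∷
  chamber 7 3 4 2 (chain O T Q R QT RT P PQ PR) Vec.∷
  chamber 7 3 6 2 (chain O T Q QT R P RT PQ PR) Vec.∷
  chamber 6 2 4 1 (chain O T Q QT R RT P PQ PR) Vec.∷
  chamber 6 5 7 3 (chain O T Q P R QT RT PQ PR) Vec.∷
  chamber 6 5 8 2 (chain O T Q P QT R RT PQ PR) Vec.∷
  chamber 5 3 6 1 (chain O T Q QT P R RT PQ PR) Vec.∷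
  chamber 4 5 6 2 (chain O T P Q R QT RT PQ PR) Vec.∷
  chamber 4 5 7 1 (chain O T P Q QT R RT PQ PR) Vec.∷
  Vec.[]

module Chambers (i : Fin 18) = Chamber (Vec.lookup chambers i)
open Chambers using (offset; order)

-- The smallest entry is chosen as `m = 1`, which makes all entries positive.
chamberMatrix : Fin 18 → Matrix
chamberMatrix i = curry (suc ∘ offset i)

abstract
  order-increasing : ∀ i → Increasing (offset i) (order i)
  order-increasing = from-yes (Fin.all? λ i → increasing? (offset i) (order i))

  order-complete : ∀ i c → c ∈ order i
  order-complete i (j , k) = from-yes
    (Fin.all? λ i → Fin.all? λ j → Fin.all? λ k → any? ((j , k) ≟_) (order i)) i j k

  -- Keeps the 18 chambers apart: a finite check of every chain at every sample point.
  order-injective : ∀ i j → Increasing (offset j) (order i) → i ≡ j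
  order-injective = from-yes
    (Fin.all? λ i → Fin.all? λ j → increasing? (offset j) (order i) →-dec i Fin.≟ j)

  chamber-rows : ∀ i k → rowSum (chamberMatrix i) k ≡ rowSum (chamberMatrix i) 0F
  chamber-rows = from-yes (Fin.all? λ i → Fin.all? λ k →
    rowSum (chamberMatrix i) k ≟ⁿ rowSum (chamberMatrix i) 0F)

  chamber-columns : ∀ i k → colSum (chamberMatrix i) k ≡ rowSum (chamberMatrix i) 0F
  chamber-columns = from-yes (Fin.all? λ i → Fin.all? λ k →
    colSum (chamberMatrix i) k ≟ⁿ rowSum (chamberMatrix i) 0F)

representative : Fin 18 → SemimagicSquare
representative i = record
  { matrix   = chamberMatrix i
  ; positive = λ _ → s≤s z≤n
  ; distinct = increasing⇒injective (order-increasing i) (order-complete i) ∘ suc-injective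
  ; lineSum  = rowSum (chamberMatrix i) 0F
  ; rows     = chamber-rows i
  ; columns  = chamber-columns i
  }

representative-increasing : ∀ i → Increasing (entry (representative i)) (order i)
representative-increasing i = Linked.map s≤s (order-increasing i)

normalOrder : Fin 18 → LinearOrdering
normalOrder i = orderType (representative i)

abstract
  normalOrder-normal : ∀ i → Normal (normalOrder i)
  normalOrder-normal i = record
    -- The corner entry is `1` and all entries are successors.
    { corner   = λ { _ (s≤s ()) }
    ; row      = from-yes (Fin.all? λ i → value i QT <? value i PR) i
    ; column   = from-yes (Fin.all? λ i → value i RT <? value i PQ) i
    ; diagonal = from-yes (Fin.all? λ i → value i QT <? value i RT) i
    }
    where
    value : Fin 18 → Cell → ℕ
    value i = suc ∘ offset i

module _ {p q r t : ℕ} (0<q : 0 < q) (0<t : 0 < t)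
         (q<r : q < r) (rt<pq : r + t < p + q)
         (block-injective : Injective _≡_ _≡_ (block p q r t)) where

  private
    connex : ∀ c d {c≢d : False (c ≟ d)} →
             block p q r t c < block p q r t d ⊎ block p q r t d < block p q r t c
    connex c d {c≢d} with <-cmp (block p q r t c) (block p q r t d)
    ... | tri< lt _ _ = inj₁ lt
    ... | tri≈ _ eq _ = contradiction (block-injective eq) (toWitnessFalse c≢d)
    ... | tri> _ _ gt = inj₂ gt

    -- Cancel `r` in `r + t < p + q < p + r`.
    t<p : t < p
    t<p = +-cancelˡ-< r t p (<-trans rt<pq (subst (p + q <_) (+-comm p r) (+-monoʳ-< p q<r)))

    t<qt : t < q + t
    t<qt = m<n+m t 0<q

    q<qt : q < q + t
    q<qt = m<m+n q 0<t

    r<rt : r < r + t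
    r<rt = m<m+n r 0<t

    p<pq : p < p + q
    p<pq = m<m+n p 0<q

    qt<rt : q + t < r + t
    qt<rt = +-monoˡ-< t q<r

    rt<pq<pr : Increasing (block p q r t) (RT ∷ PQ ∷ PR ∷ [])
    rt<pq<pr = rt<pq ∷ +-monoʳ-< p q<r ∷ [-]

    qt<rt<pq<pr : Increasing (block p q r t) (QT ∷ RT ∷ PQ ∷ PR ∷ [])
    qt<rt<pq<pr = qt<rt ∷ rt<pq<pr

    p<pq<pr : Increasing (block p q r t) (P ∷ PQ ∷ PR ∷ [])
    p<pq<pr = p<pq ∷ +-monoʳ-< p q<r ∷ [-]

  -- The constraints alone give `QT < RT < PQ < PR`, `Q < R` and `T < P`. It remains to see how the
  -- block entries interleave with these sums, and each branch skips the comparisons that its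
  -- earlier ones settle.
  block-increasing : ∃ λ i → Increasing (block p q r t) (order i)
  block-increasing = cases (connex R P) (connex Q P) (connex Q T) (connex R T)
                           (connex R QT) (connex P QT) (connex P RT)
    where
    cases : r < p ⊎ p < r → q < p ⊎ p < q → q < t ⊎ t < q → r < t ⊎ t < r →
            r < q + t ⊎ q + t < r → p < q + t ⊎ q + t < p → p < r + t ⊎ r + t < p →
            ∃ λ i → Increasing (block p q r t) (order i)
    cases (inj₁ r<p) _ (inj₁ q<t) (inj₁ r<t) _ (inj₁ p<qt) _ =
      # 0 , 0<q ∷ q<r ∷ r<t ∷ t<p ∷ p<qt ∷ qt<rt<pq<pr
    cases (inj₁ r<p) _ (inj₁ q<t) (inj₁ r<t) _ (inj₂ qt<p) (inj₁ p<rt) =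
      # 1 , 0<q ∷ q<r ∷ r<t ∷ t<qt ∷ qt<p ∷ p<rt ∷ rt<pq<pr
    cases (inj₁ r<p) _ (inj₁ q<t) (inj₁ r<t) _ (inj₂ qt<p) (inj₂ rt<p) =
      # 2 , 0<q ∷ q<r ∷ r<t ∷ t<qt ∷ qt<rt ∷ rt<p ∷ p<pq<pr
    cases (inj₁ r<p) _ (inj₁ q<t) (inj₂ t<r) (inj₁ r<qt) (inj₁ p<qt) _ =
      # 3 , 0<q ∷ q<t ∷ t<r ∷ r<p ∷ p<qt ∷ qt<rt<pq<pr
    cases (inj₁ r<p) _ (inj₁ q<t) (inj₂ t<r) (inj₁ r<qt) (inj₂ qt<p) (inj₁ p<rt) =
      # 4 , 0<q ∷ q<t ∷ t<r ∷ r<qt ∷ qt<p ∷ p<rt ∷ rt<pq<pr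
    cases (inj₁ r<p) _ (inj₁ q<t) (inj₂ t<r) (inj₁ r<qt) (inj₂ qt<p) (inj₂ rt<p) =
      # 5 , 0<q ∷ q<t ∷ t<r ∷ r<qt ∷ qt<rt ∷ rt<p ∷ p<pq<pr
    cases (inj₁ r<p) _ (inj₁ q<t) (inj₂ t<r) (inj₂ qt<r) _ (inj₁ p<rt) =
      # 6 , 0<q ∷ q<t ∷ t<qt ∷ qt<r ∷ r<p ∷ p<rt ∷ rt<pq<pr
    cases (inj₁ r<p) _ (inj₁ q<t) (inj₂ t<r) (inj₂ qt<r) _ (inj₂ rt<p) =
      # 7 , 0<q ∷ q<t ∷ t<qt ∷ qt<r ∷ r<rt ∷ rt<p ∷ p<pq<pr
    cases (inj₁ r<p) _ (inj₂ t<q) _ (inj₁ r<qt) (inj₁ p<qt) _ =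
      # 8 , 0<t ∷ t<q ∷ q<r ∷ r<p ∷ p<qt ∷ qt<rt<pq<pr
    cases (inj₁ r<p) _ (inj₂ t<q) _ (inj₁ r<qt) (inj₂ qt<p) (inj₁ p<rt) =
      # 9 , 0<t ∷ t<q ∷ q<r ∷ r<qt ∷ qt<p ∷ p<rt ∷ rt<pq<pr
    cases (inj₁ r<p) _ (inj₂ t<q) _ (inj₁ r<qt) (inj₂ qt<p) (inj₂ rt<p) =
      # 10 , 0<t ∷ t<q ∷ q<r ∷ r<qt ∷ qt<rt ∷ rt<p ∷ p<pq<pr
    cases (inj₁ r<p) _ (inj₂ t<q) _ (inj₂ qt<r) _ (inj₁ p<rt) =
      # 11 , 0<t ∷ t<q ∷ q<qt ∷ qt<r ∷ r<p ∷ p<rt ∷ rt<pq<pr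
    cases (inj₁ r<p) _ (inj₂ t<q) _ (inj₂ qt<r) _ (inj₂ rt<p) =
      # 12 , 0<t ∷ t<q ∷ q<qt ∷ qt<r ∷ r<rt ∷ rt<p ∷ p<pq<pr
    -- Impossible: adding `p < r` and `q < t` contradicts `r + t < p + q`.
    cases (inj₂ p<r) (inj₁ q<p) (inj₁ q<t) _ _ _ _ =
      contradiction (+-mono-< p<r q<t) (<-asym rt<pq)
    cases (inj₂ p<r) (inj₁ q<p) (inj₂ t<q) _ (inj₁ r<qt) _ _ =
      # 13 , 0<t ∷ t<q ∷ q<p ∷ p<r ∷ r<qt ∷ qt<rt<pq<pr
    cases (inj₂ p<r) (inj₁ q<p) (inj₂ t<q) _ (inj₂ qt<r) (inj₁ p<qt) _ =
      # 14 , 0<t ∷ t<q ∷ q<p ∷ p<qt ∷ qt<r ∷ r<rt ∷ rt<pq<pr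
    cases (inj₂ p<r) (inj₁ q<p) (inj₂ t<q) _ (inj₂ qt<r) (inj₂ qt<p) _ =
      # 15 , 0<t ∷ t<q ∷ q<qt ∷ qt<p ∷ p<r ∷ r<rt ∷ rt<pq<pr
    -- Now `t < p < q < r` orders the whole block, and only the place of `q + t` relative to `r` is
    -- open.
    cases (inj₂ p<r) (inj₂ p<q) _ _ (inj₁ r<qt) _ _ =
      # 16 , 0<t ∷ t<p ∷ p<q ∷ q<r ∷ r<qt ∷ qt<rt<pq<pr
    cases (inj₂ p<r) (inj₂ p<q) _ _ (inj₂ qt<r) _ _ =
      # 17 , 0<t ∷ t<p ∷ p<q ∷ q<qt ∷ qt<r ∷ r<rt ∷ rt<pq<pr

-- The lines with entries m, x, z and z, y₁, y₂ of a semimagic square, the zeros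
-- coming from `sum`.
crossing-lines : ∀ m u v {x y₁ y₂ z} → m + (x + (z + 0)) ≡ z + (y₁ + (y₂ + 0)) →
                 m + u ≡ y₁ → m + v ≡ y₂ → m + (u + v) ≡ x
crossing-lines m u v {x} {z = z} eq refl refl =
  -- Both lines contain `z`. Adding a further `m` to each side lets `z + m` be cancelled, which
  -- avoids subtraction.
  sym (+-cancelˡ-≡ (z + m) _ _ (trans (lhs m x z) (trans eq (rhs m u v z))))
  where
  lhs : ∀ m x z → z + m + x ≡ m + (x + (z + 0))
  lhs = solve-∀

  rhs : ∀ m u v z → z + ((m + u) + ((m + v) + 0)) ≡ z + m + (m + (u + v))
  rhs = solve-∀

module _ (S : SemimagicSquare) (N : Normal (orderType S)) where
  private
    module S = SemimagicSquare S
    module N = Normal N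

    m : ℕ
    m = entry S O

    excess : ∀ c {c≢O : False (c ≟ O)} → ∃ λ k → m + k ≡ entry S c × 0 < k
    excess c {c≢O} with m≤n⇒∃[o]m+o≡n (≮⇒≥ (N.corner c))
    ... | suc k , eq = suc k , eq , s≤s z≤n
    ... | zero , eq = contradiction
      (S.distinct (trans (sym eq) (+-identityʳ m))) (toWitnessFalse c≢O)

  -- Each noncorner cell outside the block lies on a line with the corner, and the third cell of
  -- that line lies on a line with two block cells. Equating the two sums expresses the entry
  -- through the block.
  normal⇒block : ∃ λ p → ∃ λ q → ∃ λ r → ∃ λ t → 0 < q × 0 < t ×
                 (∀ c → m + block p q r t c ≡ entry S c)
  normal⇒block with excess P | excess Q | excess R | excess T
  ... | p , eP , _ | q , eQ , 0<q | r , eR , _ | t , eT , 0<t =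
    p , q , r , t , 0<q , 0<t , λ
    { O  → +-identityʳ m
    ; QT → crossing-lines m q t (trans (S.rows 0F) (sym (S.columns 2F))) eQ eT
    ; PR → crossing-lines m p r
             (trans (last-two m (entry S PR) (entry S QT))
                    (trans (S.rows 0F) (sym (S.columns 1F)))) eP eR
    ; RT → crossing-lines m r t (trans (S.columns 0F) (sym (S.rows 2F))) eR eT
    ; P  → eP
    ; Q  → eQ
    ; PQ → crossing-lines m p q
             (trans (last-two m (entry S PQ) (entry S RT))
                    (trans (S.columns 0F) (sym (S.rows 1F)))) eP eQ
    ; R  → eR
    ; T  → eT
    }
    where
    last-two : ∀ m x y → m + (x + (y + 0)) ≡ m + (y + (x + 0))
    last-two = solve-∀

  normal⇒increasing : ∃ λ i → Increasing (entry S) (order i)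
  normal⇒increasing with normal⇒block
  ... | p , q , r , t , 0<q , 0<t , e = map₂
    (Linked.map λ {c} {d} lt → subst₂ _<_ (e c) (e d) (+-monoʳ-< m lt))
    (block-increasing 0<q 0<t
      -- With `m` cancelled, `diagonal` reads `q + t < r + t` and `column` reads `r + t < p + q`.
      (+-cancelʳ-< t q r (reduce N.diagonal))
      (reduce N.column)
      (λ {c} {d} eq → S.distinct (trans (sym (e c)) (trans (cong (m +_) eq) (e d)))))
    where
    reduce : ∀ {c d} → entry S c < entry S d → block p q r t c < block p q r t d
    reduce {c} {d} lt = +-cancelˡ-< m _ _ (subst₂ _<_ (sym (e c)) (sym (e d)) lt)

  normal⇒≋ : ∃ λ i → orderType S ≋ normalOrder i
  normal⇒≋ = i , increasing⇒≋ S (representative i) (proj₂ normal⇒increasing)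
                   (representative-increasing i) (order-complete i)
    where
    i : Fin 18
    i = proj₁ normal⇒increasing

-- Counting order types

act-cong : ∀ s t → s ≈ˢ t → ∀ c → to (act s) c ≡ to (act t) c
act-cong (false , _) (false , _) (refl , σ≈ , τ≈) (i , j) = cong₂ _,_ (σ≈ i) (τ≈ j)
act-cong (true  , _) (true  , _) (refl , σ≈ , τ≈) (i , j) = cong₂ _,_ (τ≈ j) (σ≈ i)

module OT = Setoid OrderTypes
module SC = Setoid SymmetryClasses

orderTypeOf : SemimagicSquare → OT.Carrier
orderTypeOf S = orderType S , S , λ c d → ⇔-id _

relabel-∼ : ∀ s S → orderType (relabel s S) ∼ orderType S
relabel-∼ s S = act s , act-isSymmetry s , λ c d → ⇔-id _

≋⇒∼ : ∀ X Y → X ≋ Y → X ∼ Y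
≋⇒∼ _ _ e = ↔-id _ , identity , e

∼-via-relabelling : ∀ X S S′ s → X ≋ orderType S → orderType (relabel s S) ≋ orderType S′ →
                    X ∼ orderType S′
∼-via-relabelling X S S′ s X≋S sS≋S′ =
  SC.trans {X , S , X≋S} {orderTypeOf S} {orderTypeOf S′} (≋⇒∼ X (orderType S) X≋S)
  (SC.trans {orderTypeOf S} {orderTypeOf (relabel s S)} {orderTypeOf S′}
    (SC.sym {orderTypeOf (relabel s S)} {orderTypeOf S} (relabel-∼ s S))
    (≋⇒∼ (orderType (relabel s S)) (orderType S′) sS≋S′))

∼-normalOrder : ∀ X → IsOrderType X → ∃ λ i → X ∼ normalOrder i
∼-normalOrder X (S , X≋S) = from-normal (normalise S)
  where
  from-normal : (∃ λ s → Normal (orderType (relabel s S))) → ∃ λ i → X ∼ normalOrder i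
  from-normal (s , N) = map₂
    (λ {i} → ∼-via-relabelling X S (representative i) s X≋S)
    (normal⇒≋ (relabel s S) N)

∼⇒fixed : ∀ i j ((g , _) : normalOrder i ∼ normalOrder j) → ∀ c → to g c ≡ c
∼⇒fixed i j (_ , x , e) = rigid (normalOrder-normal i) (normalOrder-normal j) x e

-- By rigidity the symmetry is the identity on cells, so the chain of `i` also increases at the
-- sample point of `j`.
∼⇒≡ : ∀ i j → normalOrder i ∼ normalOrder j → i ≡ j
∼⇒≡ i j (g , x , e) = order-injective i j
  (Linked.map
    (λ {c} {d} lt → ≤-pred
      (subst₂ (λ c′ d′ → entryⱼ c′ < entryⱼ d′) (fixed c) (fixed d) (Equivalence.to (e c d) lt)))
    (representative-increasing i))
  where
  entryⱼ : Cell → ℕ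
  entryⱼ = entry (representative j)

  fixed : ∀ c → to g c ≡ c
  fixed = ∼⇒fixed i j (g , x , e)

symmetryClasses : HasCardinality SymmetryClasses 18
symmetryClasses = record
  { to        = orderTypeOf ∘ representative
  ; cong      = λ { {i} refl → SC.refl {orderTypeOf (representative i)} }
  ; bijective = (λ {i} {j} → ∼⇒≡ i j) , surjective
  }
  where
  surjective : Surjective _≡_ SC._≈_ (orderTypeOf ∘ representative)
  surjective X = map₂
    (λ {i} e → λ { refl → SC.sym {X} {orderTypeOf (representative i)} e })
    (∼-normalOrder (proj₁ X) (proj₂ X))

-- The orbit count: every order type comes from exactly one normal one by exactly one of the
-- symmetries.
relabelling : Bijection (setoid (Fin 18) ×ₛ Symmetries) OrderTypes
relabelling = record
  { to        = relabelled
  ; cong      = λ {x} {y} → congruent {x} {y}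
  ; bijective = (λ {x} {y} → injective x y) , surjective
  }
  where
  module D = Setoid (setoid (Fin 18) ×ₛ Symmetries)

  relabelled : D.Carrier → OT.Carrier
  relabelled (i , s) = orderTypeOf (relabel s (representative i))

  ≗⇒≋ : ∀ {f g : Cell → Cell} S → (∀ c → f c ≡ g c) → ∀ c d →
        (entry S (f c) < entry S (f d)) ⇔ (entry S (g c) < entry S (g d))
  ≗⇒≋ S e c d = mk⇔
    (subst₂ (λ c′ d′ → entry S c′ < entry S d′) (e c) (e d))
    (subst₂ (λ c′ d′ → entry S c′ < entry S d′) (sym (e c)) (sym (e d)))

  congruent : ∀ {x y} → x D.≈ y → relabelled x OT.≈ relabelled y
  congruent {i , s} {_ , t} (refl , s≈t) = ≗⇒≋ (representative i) (act-cong s t s≈t)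

  injective : ∀ x y → relabelled x OT.≈ relabelled y → x D.≈ y
  -- The symmetry in `i∼j` is the inverse of `act s` followed by `act t`. It fixes every cell, hence
  -- `act s` and `act t` agree.
  injective (i , s) (j , t) e = ∼⇒≡ i j i∼j , act-injective s t λ c →
    trans (sym (∼⇒fixed i j i∼j (to (act s) c)))
          (cong (to (act t)) (Inverse.strictlyInverseʳ (act s) c))
    where
    i∼j : normalOrder i ∼ normalOrder j
    i∼j =
      SC.trans {orderTypeOf (representative i)} {relabelled (i , s)} {orderTypeOf (representative j)}
      (SC.sym {relabelled (i , s)} {orderTypeOf (representative i)}
        (relabel-∼ s (representative i)))
      (SC.trans {relabelled (i , s)} {relabelled (j , t)} {orderTypeOf (representative j)}
        (≋⇒∼ (proj₁ (relabelled (i , s))) (proj₁ (relabelled (j , t))) e)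
        (relabel-∼ t (representative j)))

  surjective : Surjective D._≈_ OT._≈_ relabelled
  surjective X = from-normal (∼-normalOrder (proj₁ X) (proj₂ X))
    where
    Preimage : Set
    Preimage = ∃ λ x → ∀ {z} → z D.≈ x → relabelled z OT.≈ X

    -- Comparing cells in `X` means comparing their images under `g` in the representative, and `g`
    -- acts as `act s`; so `X` is the order type of the representative relabelled by `s`.
    from-act : ∀ i g → Carries g (proj₁ X) (normalOrder i) →
               (∃ λ s → ∀ c → to g c ≡ to (act s) c) → Preimage
    from-act i g e (s , g≗s) = (i , s) , λ {z} z≈ →
      OT.trans {relabelled z} {relabelled (i , s)} {X} (congruent {z} z≈)
      (OT.sym {X} {relabelled (i , s)} λ c d →
        ≗⇒≋ (representative i) g≗s c d ⇔-∘ e c d)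

    from-normal : (∃ λ i → proj₁ X ∼ normalOrder i) → Preimage
    from-normal (i , g , x , e) = from-act i g e (isSymmetry⇒act x)

mainTheorem8 : HasCardinality OrderTypes 1296 × HasCardinality SymmetryClasses 18
mainTheorem8 =
  -- The count is `18 * 72`, which evaluates to `1296`.
  bijection (Identity.bijection _ ×-cardinality symmetries) relabelling , symmetryClasses
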